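{- Let $G$ be a finite connected graph, $W$ a positive weight function on $G$ (i.e. $W:V(G)\to\mathbb{Z}$ with $W(q)\ge 1$ for all $q$), and $D$ a distribution on $G$ whose set of distribution nodes relative to $W$, $\{d_1,\ldots,d_n\}=\{q\in V(G): D(q)>W(q)\}$, is nonempty. If $$V_{\{d_1,\ldots,d_n\}}(D)\ \ge\ \max_{i\in[n]} V_{\{d_i\}}(W),$$ then $D$ covers $W$.
   Context: A distribution (or weight function) on $G$ is a function $V(G)\to\mathbb{Z}_{\ge 0}$, interpreted as numbers of pebbles on vertices. For adjacent vertices $p,q$, the pebbling move $P_{p,q}$ sends $D$ to the function equal to $D(p)-2$ at $p$, $D(q)+1$ at $q$, and $D$ elsewhere; it is legal on $D$ if the result is again nonnegative (the identity is also considered a pebbling move). $D'$ is derivable from $D$ if $D'$ is obtained from $D$ by a finite sequence of legal pebbling moves. $D$ is contained in $D'$ if $D(q)\le D'(q)$ for all $q$. $D$ covers $W$ if some distribution derivable from $D$ contains $W$. For nonempty $S\subseteq V(G)$, the standard value is $V_S(D)=\sum_{q\in V(G)} D(q)\,2^{d(q,S)}$, where $d(q,S)=\min_{r\in S} d(q,r)$ and $d$ is graph distance. $[n]=\{1,\ldots,n\}$. -}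

module Defs where

open import Data.Nat using (ℕ; zero; suc; _+_; _*_; _∸_; _^_; _≤_; _<_; _⊓_; _⊔_)
open import Data.Nat.Properties using (_<?_)
open import Data.Fin using (Fin; _≟_)
open import Data.List using (List; []; _∷_; map; foldr; allFin; filter)
open import Data.Nat.ListAction using (sum)
open import Data.Product using (Σ; ∃; _×_; _,_)
open import Relation.Nullary using (¬_; yes; no)
open import Relation.Binary.PropositionalEquality using (_≡_)
open import Relation.Binary.Construct.Closure.ReflexiveTransitive using (Star)

record Graph : Set₁ where
  field
    m      : ℕ
    Adj    : Fin m → Fin m → Set
    sym    : ∀ {p q} → Adj p q → Adj q p
    irrefl : ∀ {p} → ¬ Adj p p

module _ (G : Graph) where
  open Graph G

  data Walk : Fin m → Fin m → ℕ → Set where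
    nil  : ∀ {q} → Walk q q 0
    cons : ∀ {q s r k} → Adj q s → Walk s r k → Walk q r (suc k)

  Connected : Set
  Connected = ∀ p q → ∃ λ k → Walk p q k

  IsDistance : (Fin m → Fin m → ℕ) → Set
  IsDistance d = ∀ p q → Walk p q (d p q) × (∀ k → Walk p q k → d p q ≤ k)

  Distribution : Set
  Distribution = Fin m → ℕ

  move : Fin m → Fin m → Distribution → Distribution
  move p q D x with x ≟ p
  ... | yes _ = D p ∸ 2
  ... | no _ with x ≟ q
  ...   | yes _ = D q + 1
  ...   | no _  = D x

  -- a legal pebbling move (identity handled by reflexivity of Star)
  Step : Distribution → Distribution → Set
  Step D D' = Σ (Fin m) λ p → Σ (Fin m) λ q → Adj p q × 2 ≤ D p × D' ≡ move p q D

  Derivable : Distribution → Distribution → Set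
  Derivable = Star Step

  Contains : Distribution → Distribution → Set
  Contains W D' = ∀ q → W q ≤ D' q

  Covers : Distribution → Distribution → Set
  Covers D W = ∃ λ D' → Derivable D D' × Contains W D'

  module _ (d : Fin m → Fin m → ℕ) where
    distTo : Fin m → List (Fin m) → ℕ
    distTo q [] = 0
    distTo q (r ∷ rs) = foldr (λ r' acc → d q r' ⊓ acc) (d q r) rs

    V : List (Fin m) → Distribution → ℕ
    V S D = sum (map (λ q → D q * 2 ^ distTo q S) (allFin m))

  distNodes : Distribution → Distribution → List (Fin m)
  distNodes D W = filter (λ q → W q <? D q) (allFin m)

  maxList : List ℕ → ℕ
  maxList = foldr _⊔_ 0

{-# OPTIONS --safe #-}
-- Let S be the set of distribution nodes and weigh each pebble on q by
-- 2 ^ d(q , S).  A move from p to a neighbour s that is one step farther from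
-- S preserves the value V_S.  If some node t has too few pebbles, follow a
-- shortest path from S to t; after shortening it to end at the first deficient
-- node, its inner nodes all satisfy D ≥ W ≥ 1, so pushing two pebbles from its
-- source along the path is legal, takes one pebble from every inner node and
-- adds one to the target.  The number of pebbles drops, V_S is unchanged and no
-- new distribution node appears, so distances to the set of distribution nodes
-- can only grow and the hypothesis survives.  When the last distribution node
-- vanishes, D ≤ W while V_r(D) ≥ V_r(W) for some r, which forces D = W.
module Submission where

open import Defs
open import Data.Nat using (ℕ; zero; suc; _+_; _*_; _∸_; _^_; _≤_; _<_; z≤n; s≤s)
open import Data.Nat.Properties hiding (_≟_)
open import Data.Nat.Induction using (Acc; acc; <-wellFounded)
open import Data.Nat.ListAction using (sum)
open import Data.Nat.Solver using (module +-*-Solver)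
open import Data.Fin using (Fin; zero; suc; _≟_)
open import Data.Fin.Properties using (any?)
open import Data.List using (List; []; _∷_; map; allFin; tabulate)
open import Data.List.Properties using (map-tabulate)
open import Data.List.Membership.Propositional using (_∈_)
open import Data.List.Membership.Propositional.Properties using (∈-filter⁺; ∈-filter⁻; ∈-allFin)
open import Data.List.Relation.Unary.Any using (here; there)
open import Data.Product using (∃; _×_; _,_; proj₁; proj₂)
open import Data.Sum using (inj₁; inj₂)
open import Relation.Nullary using (¬_; yes; no; contradiction)
open import Relation.Binary.PropositionalEquality using (_≡_; _≢_; refl; sym; trans; cong; cong₂; subst; module ≡-Reasoning)
open import Relation.Binary.Construct.Closure.ReflexiveTransitive using (ε; _◅_; _◅◅_)

-- Finite sums over lists and over all vertices.

sum-map-cong : {A : Set} {f g : A → ℕ} → (∀ x → f x ≡ g x) →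
  ∀ xs → sum (map f xs) ≡ sum (map g xs)
sum-map-cong f≡g []       = refl
sum-map-cong f≡g (x ∷ xs) = cong₂ _+_ (f≡g x) (sum-map-cong f≡g xs)

sum-map-+ : {A : Set} (f g : A → ℕ) → ∀ xs →
  sum (map (λ x → f x + g x) xs) ≡ sum (map f xs) + sum (map g xs)
sum-map-+ f g []       = refl
sum-map-+ f g (x ∷ xs) rewrite sum-map-+ f g xs =
  solve 4 (λ a b c d → (a :+ b) :+ (c :+ d) := (a :+ c) :+ (b :+ d)) refl
    (f x) (g x) (sum (map f xs)) (sum (map g xs))
  where open +-*-Solver

sum-map-mono-≤ : {A : Set} {f g : A → ℕ} → (∀ x → f x ≤ g x) →
  ∀ xs → sum (map f xs) ≤ sum (map g xs)
sum-map-mono-≤ f≤g []       = z≤n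
sum-map-mono-≤ f≤g (x ∷ xs) = +-mono-≤ (f≤g x) (sum-map-mono-≤ f≤g xs)

sum-map-mono-< : {A : Set} {f g : A → ℕ} → (∀ x → f x ≤ g x) →
  ∀ {y xs} → y ∈ xs → f y < g y → sum (map f xs) < sum (map g xs)
sum-map-mono-< f≤g {xs = _ ∷ xs} (here refl) fy<gy = +-mono-<-≤ fy<gy (sum-map-mono-≤ f≤g xs)
sum-map-mono-< f≤g {xs = x ∷ _} (there y∈xs) fy<gy = +-mono-≤-< (f≤g x) (sum-map-mono-< f≤g y∈xs fy<gy)

-- Writes a change at a single vertex as a function on all vertices, so that `weight-move` reduces
-- to a pointwise identity under the sum.
point : ∀ {n} → Fin n → ℕ → Fin n → ℕ
point p v x with x ≟ p
... | yes _ = v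
... | no  _ = 0

sum-tabulate-zero : ∀ n {f : Fin n → ℕ} → (∀ x → f x ≡ 0) → sum (tabulate f) ≡ 0
sum-tabulate-zero zero    f≡0 = refl
sum-tabulate-zero (suc n) f≡0 = cong₂ _+_ (f≡0 zero) (sum-tabulate-zero n (λ x → f≡0 (suc x)))

sum-tabulate-single : ∀ {n} {f : Fin n → ℕ} (p : Fin n) →
  (∀ x → x ≢ p → f x ≡ 0) → sum (tabulate f) ≡ f p
sum-tabulate-single {suc n} {f} zero    f≡0 =
  trans (cong (f zero +_) (sum-tabulate-zero n (λ x → f≡0 (suc x) λ ()))) (+-identityʳ _)
sum-tabulate-single (suc p) f≡0 =
  cong₂ _+_ (f≡0 zero λ ())
    (sum-tabulate-single p (λ x x≢p → f≡0 (suc x) λ { refl → x≢p refl }))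

sum-point : ∀ {n} (p : Fin n) v → sum (map (point p v) (allFin n)) ≡ v
sum-point {n} p v = begin
  sum (map (point p v) (allFin n)) ≡⟨ cong sum (map-tabulate (λ x → x) (point p v)) ⟩
  sum (tabulate (point p v))       ≡⟨ sum-tabulate-single p off ⟩
  point p v p                      ≡⟨ on ⟩
  v                                ∎
  where
  open ≡-Reasoning
  off : ∀ x → x ≢ p → point p v x ≡ 0
  off x x≢p with x ≟ p
  ... | yes x≡p = contradiction x≡p x≢p
  ... | no  _   = refl
  on : point p v p ≡ v
  on with p ≟ p
  ... | yes _   = refl
  ... | no  p≢p = contradiction refl p≢p

-- Weighted pebble counts and the effect of one move.

module _ (G : Graph) where
  open Graph G using (m; Adj)

  -- Gives the standard value when `c q` is 2 to the distance of `q` from the set, and the number of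
  -- pebbles when `c` is constantly 1; one identity for a move serves both.
  weight : (Fin m → ℕ) → Distribution G → ℕ
  weight c D = sum (map (λ q → D q * c q) (allFin m))

  size : Distribution G → ℕ
  size = weight (λ _ → 1)

  -- Since all coefficients are positive, a strict deficit at one vertex would make the whole
  -- weighted sum strictly smaller.
  ≤∧weight≥⇒≥ : ∀ {c D E} → (∀ q → 0 < c q) → (∀ q → D q ≤ E q) →
    weight c E ≤ weight c D → ∀ q → E q ≤ D q
  ≤∧weight≥⇒≥ {c} {D} {E} c>0 D≤E wE≤wD q with E q ≤? D q
  ... | yes Eq≤Dq = Eq≤Dq
  ... | no  Eq≰Dq = contradiction wE≤wD (<⇒≱
          (sum-map-mono-< (λ x → *-monoˡ-≤ (c x) (D≤E x)) (∈-allFin q) strict))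
    where
    strict : D q * c q < E q * c q
    strict with c q | c>0 q
    ... | suc k | _ = *-monoˡ-< (suc k) (≰⇒> Eq≰Dq)

  module _ {p q : Fin m} (p≢q : p ≢ q) (D : Distribution G) where

    move-source : move G p q D p ≡ D p ∸ 2
    move-source with p ≟ p
    ... | yes _   = refl
    ... | no  p≢p = contradiction refl p≢p

    move-target : move G p q D q ≡ suc (D q)
    move-target with q ≟ p
    ... | yes q≡p = contradiction (sym q≡p) p≢q
    ... | no  _ with q ≟ q
    ...   | yes _   = +-comm (D q) 1
    ...   | no  q≢q = contradiction refl q≢q

    move-lower : ∀ x → x ≢ p → D x ≤ move G p q D x
    move-lower x x≢p with x ≟ p
    ... | yes x≡p = contradiction x≡p x≢p
    ... | no  _ with x ≟ q
    ...   | yes refl = m≤m+n (D q) 1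
    ...   | no  _    = ≤-refl

    move-upper : ∀ x → x ≢ q → move G p q D x ≤ D x
    move-upper x x≢q with x ≟ p
    ... | yes refl = m∸n≤m (D p) 2
    ... | no  _ with x ≟ q
    ...   | yes x≡q = contradiction x≡q x≢q
    ...   | no  _   = ≤-refl

    -- A move loses `2 * c p` and gains `c q`; the loss stands on the left to avoid truncated
    -- subtraction.
    weight-move : ∀ c → 2 ≤ D p →
      weight c (move G p q D) + 2 * c p ≡ weight c D + c q
    weight-move c 2≤Dp = begin
      weight c D′ + 2 * c p
        ≡⟨ cong (weight c D′ +_) (sym (sum-point p (2 * c p))) ⟩
      weight c D′ + sum (map (point p (2 * c p)) (allFin m))
        ≡⟨ sym (sum-map-+ _ _ (allFin m)) ⟩
      sum (map (λ x → D′ x * c x + point p (2 * c p) x) (allFin m))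
        ≡⟨ sum-map-cong pointwise (allFin m) ⟩
      sum (map (λ x → D x * c x + point q (c q) x) (allFin m))
        ≡⟨ sum-map-+ _ _ (allFin m) ⟩
      weight c D + sum (map (point q (c q)) (allFin m))
        ≡⟨ cong (weight c D +_) (sum-point q (c q)) ⟩
      weight c D + c q ∎
      where
      open ≡-Reasoning
      D′ = move G p q D
      pointwise : ∀ x → D′ x * c x + point p (2 * c p) x ≡ D x * c x + point q (c q) x
      pointwise x with x ≟ p
      ... | yes refl with x ≟ q
      ...   | yes p≡q = contradiction p≡q p≢q
      ...   | no  _   = begin
        (D p ∸ 2) * c p + 2 * c p ≡⟨ sym (*-distribʳ-+ (c p) (D p ∸ 2) 2) ⟩
        (D p ∸ 2 + 2) * c p       ≡⟨ cong (_* c p) (m∸n+n≡m 2≤Dp) ⟩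
        D p * c p                 ≡⟨ sym (+-identityʳ _) ⟩
        D p * c p + 0             ∎
      pointwise x | no _ with x ≟ q
      ...   | yes refl = solve 2 (λ a b → (a :+ con 1) :* b :+ con 0 := a :* b :+ b) refl (D q) (c q)
        where open +-*-Solver
      ...   | no  _    = refl

  -- Pushing pebbles along a shortest path.

  -- The level function e stands for the distance to the set of distribution
  -- nodes; D₀ only witnesses that the vertices before the end carry a pebble.
  module Push (e : Fin m → ℕ) (D₀ : Distribution G) where

    data Trail (t : Fin m) : Fin m → Set where
      stop : Trail t t
      step : ∀ {p s} → Adj p s → e s ≡ suc (e p) → 1 ≤ D₀ p → Trail t s → Trail t p

    Trail⇒≤ : ∀ {s t} → Trail t s → e s ≤ e t
    Trail⇒≤ stop             = ≤-refl
    Trail⇒≤ (step _ es _ tr) = <⇒≤ (<-≤-trans (≤-reflexive (sym es)) (Trail⇒≤ tr))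

    -- Bounds suffice in place of the exact result: only `t` may gain, and by at most one pebble.
    -- The strict bound `source` serves the induction.
    record Pushed (D : Distribution G) (p t : Fin m) : Set where
      field
        result      : Distribution G
        derivable   : Derivable G D result
        value       : weight (λ q → 2 ^ e q) result ≡ weight (λ q → 2 ^ e q) D
        smaller     : size result < size D
        source      : result p < D p
        target      : result t ≤ suc (D t)
        elsewhere   : ∀ x → x ≢ t → result x ≤ D x

    -- Induction on the trail. The lower bound on `D` is asked only at levels above `p`, because the
    -- moves already made have taken pebbles from lower levels only.
    push : ∀ {p s t} (D : Distribution G) → Adj p s → e s ≡ suc (e p) → Trail t s →
      2 ≤ D p → (∀ x → e p < e x → D₀ x ≤ D x) → Pushed D p t
    push {p} {s} {t} D adj es tr 2≤Dp above = go tr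
      where
      D₁ = move G p s D

      p<⇒≢ : ∀ {x} → e p < e x → x ≢ p
      p<⇒≢ lt refl = <-irrefl refl lt

      ep<es : e p < e s
      ep<es = ≤-reflexive (sym es)

      p≢s : p ≢ s
      p≢s p≡s = p<⇒≢ ep<es (sym p≡s)

      value₁ : weight (λ q → 2 ^ e q) D₁ ≡ weight (λ q → 2 ^ e q) D
      -- `2 ^ suc (e p)` unfolds to `2 * 2 ^ e p`, so the move adds exactly the value it removes.
      value₁ = +-cancelʳ-≡ (2 ^ suc (e p)) _ _
        (trans (weight-move p≢s D (λ q → 2 ^ e q) 2≤Dp)
               (cong (λ k → weight (λ q → 2 ^ e q) D + 2 ^ k) es))

      smaller₁ : size D₁ < size D
      smaller₁ = +-cancelʳ-≤ 1 _ _ (≤-reflexive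
        (trans (sym (+-suc (size D₁) 1)) (weight-move p≢s D (λ _ → 1) 2≤Dp)))

      source₁ : D₁ p < D p
      source₁ rewrite move-source p≢s D = ∸-monoʳ-< {D p} {2} {0} (s≤s z≤n) 2≤Dp

      go : Trail t s → Pushed D p t
      go stop = record
        { result    = D₁
        ; derivable = (p , s , adj , 2≤Dp , refl) ◅ ε
        ; value     = value₁
        ; smaller   = smaller₁
        ; source    = source₁
        ; target    = ≤-reflexive (move-target p≢s D)
        ; elsewhere = move-upper p≢s D
        }
      go (step {s = u} adj′ eu 1≤D₀s tr′) = record
        { result    = R.result
        ; derivable = (p , s , adj , 2≤Dp , refl) ◅ R.derivable
        ; value     = trans R.value value₁
        ; smaller   = <-trans R.smaller smaller₁
        -- Levels rise along the trail, so `t` is not `p` and the later moves leave no gain at `p`.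
        ; source    = ≤-<-trans (R.elsewhere p (λ p≡t → p<⇒≢ ep<et (sym p≡t))) source₁
        ; target    = ≤-trans R.target (s≤s (move-upper p≢s D t t≢s))
        ; elsewhere = elsewhere′
        }
        where
        es<et : e s < e t
        es<et = <-≤-trans (≤-reflexive (sym eu)) (Trail⇒≤ tr′)

        ep<et : e p < e t
        ep<et = <-trans ep<es es<et

        t≢s : t ≢ s
        t≢s t≡s = <-irrefl (cong e (sym t≡s)) es<et

        2≤D₁s : 2 ≤ D₁ s
        -- One pebble has just arrived at `s`; the other is the one the trail guarantees there.
        2≤D₁s rewrite move-target p≢s D = s≤s (≤-trans 1≤D₀s (above s ep<es))

        above₁ : ∀ x → e s < e x → D₀ x ≤ D₁ x
        above₁ x es<ex =
          ≤-trans (above x (<-trans ep<es es<ex)) (move-lower p≢s D x (p<⇒≢ (<-trans ep<es es<ex)))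

        rest : Pushed D₁ s t
        rest = push D₁ adj′ eu tr′ 2≤D₁s above₁

        module R = Pushed rest

        elsewhere′ : ∀ x → x ≢ t → R.result x ≤ D x
        elsewhere′ x x≢t with x ≟ s
        -- The move into `s` adds one pebble and the rest of the push takes away at least one.
        ... | yes refl = ≤-pred (subst (R.result s <_) (move-target p≢s D) R.source)
        ... | no  x≢s  = ≤-trans (R.elsewhere x x≢t) (move-upper p≢s D x x≢s)

  -- Maxima, distribution nodes and distance to a set.

  ≤-maxList : ∀ (f : Fin m → ℕ) {r S} → r ∈ S → f r ≤ maxList G (map f S)
  ≤-maxList f (here refl) = m≤m⊔n _ _
  ≤-maxList f (there r∈S) = ≤-trans (≤-maxList f r∈S) (m≤n⊔m _ _)

  module _ (D W : Distribution G) where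

    ∈-distNodes⁺ : ∀ {q} → W q < D q → q ∈ distNodes G D W
    ∈-distNodes⁺ {q} = ∈-filter⁺ (λ q → W q <? D q) (∈-allFin q)

    ∈-distNodes⁻ : ∀ {q} → q ∈ distNodes G D W → W q < D q
    ∈-distNodes⁻ q∈ = proj₂ (∈-filter⁻ (λ q → W q <? D q) {xs = allFin m} q∈)

  module _ (d : Fin m → Fin m → ℕ) where

    -- The fold starts from the head, so `distTo` on `s ∷ u ∷ S` unfolds to `d q u ⊓ distTo` on
    -- `s ∷ S`: the recursion drops the second element.
    distTo-≤ : ∀ q {r S} → r ∈ S → distTo G d q S ≤ d q r
    distTo-≤ q {S = s ∷ []}     (here refl)         = ≤-refl
    distTo-≤ q {S = s ∷ u ∷ S}  (here refl)         = ≤-trans (m⊓n≤n (d q u) _) (distTo-≤ q {S = s ∷ S} (here refl))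
    distTo-≤ q {S = s ∷ u ∷ S}  (there (here refl)) = m⊓n≤m (d q u) _
    distTo-≤ q {S = s ∷ u ∷ S}  (there (there r∈S)) = ≤-trans (m⊓n≤n (d q u) _) (distTo-≤ q {S = s ∷ S} (there r∈S))

    distTo-attained : ∀ q {S} → S ≢ [] → ∃ λ r → r ∈ S × distTo G d q S ≡ d q r
    distTo-attained q {[]}        S≢[] = contradiction refl S≢[]
    distTo-attained q {s ∷ []}    _    = s , here refl , refl
    distTo-attained q {s ∷ u ∷ S} _
      with distTo-attained q {s ∷ S} (λ ()) | ⊓-sel (d q u) (distTo G d q (s ∷ S))
    ... | r , here refl , eq | inj₂ sel = r , here refl , trans sel eq
    ... | r , there r∈S , eq | inj₂ sel = r , there (there r∈S) , trans sel eq
    ... | _                  | inj₁ sel = u , there (here refl) , sel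

    -- `T` must be nonempty because `distTo` takes the default value 0 on the empty list.
    distTo-antimono : ∀ q {S T} → T ≢ [] → (∀ {r} → r ∈ T → r ∈ S) →
      distTo G d q S ≤ distTo G d q T
    distTo-antimono q T≢[] T⊆S with distTo-attained q T≢[]
    ... | r , r∈T , eq = ≤-trans (distTo-≤ q (T⊆S r∈T)) (≤-reflexive (sym eq))

    V-mono : ∀ D S T → (∀ q → distTo G d q S ≤ distTo G d q T) → V G d S D ≤ V G d T D
    V-mono D S T S≤T = sum-map-mono-≤ (λ q → *-monoʳ-≤ (D q) (^-monoʳ-≤ 2 (S≤T q))) (allFin m)

  module _ (d : Fin m → Fin m → ℕ) (isDistance : IsDistance G d) where

    distTo-zero : ∀ q {S} → S ≢ [] → distTo G d q S ≡ 0 → q ∈ S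
    distTo-zero q S≢[] eq₀ with distTo-attained d q S≢[]
    ... | r , r∈S , eq with d q r | proj₁ (isDistance q r) | trans (sym eq₀) eq
    ...   | zero | nil | _ = r∈S

    distTo-adj : ∀ {q s S} → S ≢ [] → Adj q s → distTo G d q S ≤ suc (distTo G d s S)
    distTo-adj {q} {s} S≢[] adj with distTo-attained d s S≢[]
    ... | r , r∈S , eq = ≤-trans (distTo-≤ d q r∈S)
            (subst (λ k → d q r ≤ suc k) (sym eq)
              (proj₂ (isDistance q r) _ (cons adj (proj₁ (isDistance s r)))))

    -- Take the first step of a shortest walk to a nearest `r`: the rest of the walk bounds the new
    -- distance above, `distTo-adj` below.
    distTo-pred : ∀ q {S n} → S ≢ [] → distTo G d q S ≡ suc n →
      ∃ λ s → Adj s q × distTo G d s S ≡ n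
    distTo-pred q S≢[] eqₙ with distTo-attained d q S≢[]
    ... | r , r∈S , eq with d q r | proj₁ (isDistance q r) | trans (sym eqₙ) eq
    ...   | _ | cons {s = s} {k = k} adj w | refl =
      s , Graph.sym G adj , ≤-antisym
        (≤-trans (distTo-≤ d s r∈S) (proj₂ (isDistance s r) k w))
        (≤-pred (≤-trans (≤-reflexive (sym eqₙ)) (distTo-adj S≢[] adj)))

    -- Improving a deficient node and iterating.

    module _ (W : Distribution G) (W≥1 : ∀ q → 1 ≤ W q) where

      module Improve (D : Distribution G) (S≢[] : distNodes G D W ≢ []) where
        S = distNodes G D W
        e = λ q → distTo G d q S
        open Push e D public

        Improvement : Set
        Improvement = ∃ λ p → ∃ λ t → D t < W t × Pushed D p t

        -- An empty trail would make `t` both deficient and a distribution node; otherwise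
        -- `D p > W p ≥ 1` supplies two pebbles.
        push-from-source : ∀ {p t} → p ∈ S → D t < W t → Trail t p → Improvement
        push-from-source p∈S t-thin stop =
          contradiction t-thin (<-asym (∈-distNodes⁻ D W p∈S))
        push-from-source {p} p∈S t-thin (step adj es _ tr) =
          _ , _ , t-thin , push D adj es tr
            (≤-trans (s≤s (W≥1 p)) (∈-distNodes⁻ D W p∈S)) (λ _ _ → ≤-refl)

        -- Walks from s towards S, restarting the trail at each deficient node.
        improve-along : ∀ n {s t} → e s ≡ n → D t < W t → Trail t s → Improvement
        improve-along zero    {s} es t-thin tr = push-from-source (distTo-zero s S≢[] es) t-thin tr
        improve-along (suc n) {s} es t-thin tr with distTo-pred s S≢[] es
        ... | u , adj , eu with D u <? W u
        ...   | yes u-thin = improve-along n eu u-thin stop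
        ...   | no  u-full = improve-along n eu t-thin
                  (step adj (trans es (cong suc (sym eu))) (≤-trans (W≥1 u) (≮⇒≥ u-full)) tr)

        improve : ∀ {t} → D t < W t → Improvement
        improve t-thin = improve-along _ refl t-thin stop

      -- Induction on the number of pebbles. The hypothesis is kept for each `r` rather than as a
      -- maximum, so that it restricts at once to fewer distribution nodes.
      covers : ∀ D → Acc _<_ (size D) → distNodes G D W ≢ [] →
        (∀ r → r ∈ distNodes G D W → V G d (r ∷ []) W ≤ V G d (distNodes G D W) D) →
        Covers G D W
      covers D (acc rs) S≢[] enough with any? (λ q → D q <? W q)
      ... | no  none = D , ε , λ q → ≮⇒≥ (λ Dq<Wq → none (q , Dq<Wq))
      ... | yes (_ , deficient) with Improve.improve D S≢[] deficient
      ...   | p , t , t-thin , pushed = conclude (distNodes G D′ W) refl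
        where
        open Improve.Pushed D S≢[] pushed renaming (result to D′)
        S = distNodes G D W

        S′⊆S : ∀ {r} → r ∈ distNodes G D′ W → r ∈ S
        S′⊆S {r} r∈S′ with r ≟ t
        -- `t` was deficient and gained at most one pebble, so it holds at most `W t`.
        ... | yes refl = contradiction (∈-distNodes⁻ D′ W r∈S′) (≤⇒≯ (≤-trans target t-thin))
        ... | no  r≢t  = ∈-distNodes⁺ D W (<-≤-trans (∈-distNodes⁻ D′ W r∈S′) (elsewhere r r≢t))

        enough′ : ∀ r → r ∈ S → V G d (r ∷ []) W ≤ V G d S D′
        enough′ r r∈S = ≤-trans (enough r r∈S) (≤-reflexive (sym value))

        conclude : ∀ T → distNodes G D′ W ≡ T → Covers G D W
        -- With no distribution node left, the old `S` is used: any `r` in it gives V_r(W) ≤ V_S(D′)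
        -- ≤ V_r(D′).
        conclude [] S′≡[] with distTo-attained d t S≢[]
        ... | r , r∈S , _ = D′ , derivable ,
          ≤∧weight≥⇒≥ (λ q → m^n>0 2 (d q r)) D′≤W
            (≤-trans (enough′ r r∈S) (V-mono d D′ S (r ∷ []) (λ q → distTo-≤ d q r∈S)))
          where
          D′≤W : ∀ q → D′ q ≤ W q
          D′≤W q = ≮⇒≥ λ W<D′ → contradiction (subst (q ∈_) S′≡[] (∈-distNodes⁺ D′ W W<D′)) λ ()
        conclude (_ ∷ _) S′≡T = extend (covers D′ (rs smaller) S′≢[] enough″)
          where
          S′≢[] : distNodes G D′ W ≢ []
          S′≢[] S′≡[] = contradiction (trans (sym S′≡T) S′≡[]) λ ()

          enough″ : ∀ r → r ∈ distNodes G D′ W → V G d (r ∷ []) W ≤ V G d (distNodes G D′ W) D′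
          enough″ r r∈S′ = ≤-trans (enough′ r (S′⊆S r∈S′))
            (V-mono d D′ S (distNodes G D′ W) (λ q → distTo-antimono d q S′≢[] S′⊆S))

          extend : Covers G D′ W → Covers G D W
          extend (E , D′⇒E , W≤E) = E , derivable ◅◅ D′⇒E , W≤E

theorem1 : (G : Graph) → Connected G →
    (d : Fin (Graph.m G) → Fin (Graph.m G) → ℕ) → IsDistance G d →
    (W D : Distribution G) → (∀ q → 1 ≤ W q) →
    ¬ (distNodes G D W ≡ []) →
    maxList G (map (λ r → V G d (r ∷ []) W) (distNodes G D W)) ≤ V G d (distNodes G D W) D →
    Covers G D W
theorem1 G _ d isDistance W D W≥1 S≢[] max≤V =
  covers G d isDistance W W≥1 D (<-wellFounded _) S≢[]
    (λ r r∈S → ≤-trans (≤-maxList G (λ r → V G d (r ∷ []) W) r∈S) max≤V)
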